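{- Let $\lambda$ be a nonzero real (or complex) number and let $k\ge 2$ be an integer. Then, as power series in $x$, $$\sum_{n=0}^{\infty}\beta_{n,\lambda}^{(k)}\frac{x^{n}}{n!}=\frac{1}{1-e_{\lambda}(-x)}\int_{0}^{x}\underbrace{\frac{e_{\lambda}^{1-\lambda}(-t)}{1-e_{\lambda}(-t)}\int_{0}^{t}\frac{e_{\lambda}^{1-\lambda}(-t)}{1-e_{\lambda}(-t)}\cdots\int_{0}^{t}}_{(k-2)\text{ times}}\frac{e_{\lambda}^{1-\lambda}(-t)}{1-e_{\lambda}(-t)}\,t\,dt\,dt\cdots dt,$$ where the iterated integral (with $k-1$ integral signs in total) means $J_k(x)$, with $J_1(x)=x$ and, for $j\ge 2$, $$J_j(x)=\int_0^x \frac{e_{\lambda}^{1-\lambda}(-t)}{1-e_{\lambda}(-t)}\,J_{j-1}(t)\,dt .$$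
   Context: All identities are between formal power series (equivalently, convergent power series for small argument). For nonzero $\lambda$ and any $x$, the degenerate exponential is $e_\lambda^x(t)=(1+\lambda t)^{x/\lambda}=\sum_{n\ge0}\binom{x/\lambda}{n}\lambda^n t^n$ and $e_\lambda(t)=e_\lambda^1(t)$. For nonzero $\mu$, put $(1)_{0,\mu}=1$ and $(1)_{n,\mu}=(1-\mu)(1-2\mu)\cdots(1-(n-1)\mu)$ for $n\ge1$ (so $(1)_{1,\mu}=1$). For $k\in\mathbb{Z}$ the degenerate polylogarithm function is $l_{k,\lambda}(x)=\sum_{n=1}^{\infty}\frac{(-\lambda)^{n-1}(1)_{n,1/\lambda}}{(n-1)!\,n^{k}}x^{n}$, and the degenerate poly-Bernoulli numbers $\beta_{n,\lambda}^{(k)}$ are defined by $$\frac{l_{k,\lambda}(1-e_{\lambda}(-t))}{1-e_{\lambda}(-t)}=\sum_{n=0}^{\infty}\beta_{n,\lambda}^{(k)}\frac{t^{n}}{n!},$$ i.e. by substituting $x=1-e_\lambda(-t)$ (which has zero constant term) into the power series $l_{k,\lambda}(x)/x$. -}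

module Defs where

open import Algebra.Apartness.Bundles using (HeytingField; HeytingCommutativeRing)
open import Algebra.Bundles using (CommutativeRing; Semiring)
import Algebra.Apartness.Properties.HeytingCommutativeRing as HeytingProperties
import Algebra.Definitions.RawSemiring as RawSemiringDefinitions
import Algebra.Properties.Ring as RingProperties
open import Data.Fin.Base using (toℕ)
open import Data.Integer.Base as ℤ using (ℤ; +_; -[1+_])
open import Data.Nat.Base using (ℕ; zero; suc; NonZero; _!; _∸_)
open import Data.Nat.Properties using (_!≢0)
open import Data.Product.Base using (proj₁; proj₂)
import Relation.Binary.Reasoning.Setoid as ≈-Reasoning

module FieldOps {c ℓ₁ ℓ₂} (F : HeytingField c ℓ₁ ℓ₂) where
  open HeytingField F public
  open HeytingCommutativeRing heytingCommutativeRing public using (commutativeRing)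
  open CommutativeRing commutativeRing public using (ring; semiring)
  open Semiring semiring public using (rawSemiring)
  open RawSemiringDefinitions rawSemiring public using (_×_; _^_; sum)
  open HeytingProperties heytingCommutativeRing public

  infix 9 _⁻¹
  _⁻¹ : ∀ {x} → x # 0# → Carrier
  x#0 ⁻¹ = proj₁ (#⇒invertible x#0)

  ⁻¹-inverseˡ : ∀ {x} (x#0 : x # 0#) → x#0 ⁻¹ * x ≈ 1#
  ⁻¹-inverseˡ {x} x#0 =
    trans (*-congˡ (sym (x-0≈x x))) (proj₁ (proj₂ (#⇒invertible x#0)))

  -- ℝ and ℂ are the intended instances; _#_ plays the role of ≠.
  CharacteristicZero : Set ℓ₂
  CharacteristicZero = ∀ n → .{{_ : NonZero n}} → n × 1# # 0#

module PowerSeries {c ℓ₁ ℓ₂} (F : HeytingField c ℓ₁ ℓ₂)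
                   (charZero : FieldOps.CharacteristicZero F) where
  open FieldOps F

  PS : Set c
  PS = ℕ → Carrier

  infix 4 _≋_
  _≋_ : PS → PS → Set ℓ₁
  f ≋ g = ∀ n → f n ≈ g n

  1/ℕ : ∀ n → .{{_ : NonZero n}} → Carrier
  1/ℕ n = charZero n ⁻¹

  1/_! : ℕ → Carrier
  1/ n ! = 1/ℕ (n !) {{n !≢0}}

  1ₚ : PS
  1ₚ zero    = 1#
  1ₚ (suc _) = 0#

  var : PS
  var zero          = 0#
  var (suc zero)    = 1#
  var (suc (suc _)) = 0#

  infixl 6 _⊖_
  infixl 7 _⊛_ _∙_
  infixr 8 _^ₚ_

  _⊖_ : PS → PS → PS
  (f ⊖ g) n = f n - g n

  _∙_ : Carrier → PS → PS
  (a ∙ f) n = a * f n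

  _⊛_ : PS → PS → PS
  (f ⊛ g) n = sum {suc n} λ i → f (toℕ i) * g (n ∸ toℕ i)

  _^ₚ_ : PS → ℕ → PS
  f ^ₚ zero  = 1ₚ
  f ^ₚ suc n = f ⊛ f ^ₚ n

  reflect : PS → PS   -- f(-t)
  reflect f n = (- 1#) ^ n * f n

  -- f(h(t)).  As h has zero constant term, h^i does not contribute to
  -- the coefficient of tⁿ for i > n.
  substitute : (f h : PS) → h 0 ≈ 0# → PS
  substitute f h _ n = sum {suc n} λ i → f (toℕ i) * (h ^ₚ toℕ i) n

  divideByVar : (f : PS) → f 0 ≈ 0# → PS   -- f(t)/t
  divideByVar f _ n = f (suc n)

  1-x⁻¹x≈0 : ∀ {x} (x#0 : x # 0#) → 1# - x#0 ⁻¹ * x ≈ 0#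
  1-x⁻¹x≈0 x#0 = trans (+-congˡ (-‿cong (⁻¹-inverseˡ x#0))) (-‿inverseʳ 1#)

  -- 1/g = a Σᵢ (1 - a g)ⁱ, where a is the inverse of the constant term of g.
  inverse : (g : PS) → g 0 # 0# → PS
  inverse g g₀#0 = a ∙ substitute (λ _ → 1#) (1ₚ ⊖ a ∙ g) (1-x⁻¹x≈0 g₀#0)
    where
    a : Carrier
    a = g₀#0 ⁻¹

  -- f/g for f of order ≥ 1 and g of order exactly 1, as (f/t) · (g/t)⁻¹:
  -- the simple pole of 1/g is cancelled by the zero of f.
  quotient : (f g : PS) → f 0 ≈ 0# → g 0 ≈ 0# → g 1 # 0# → PS
  quotient f g f₀≈0 g₀≈0 g₁#0 =
    divideByVar f f₀≈0 ⊛ inverse (divideByVar g g₀≈0) g₁#0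

  ∫₀ : PS → PS
  ∫₀ f zero    = 0#
  ∫₀ f (suc n) = f n * 1/ℕ (suc n)

  egf : (ℕ → Carrier) → PS
  egf a n = a n * 1/ n !

module Degenerate {c ℓ₁ ℓ₂} (F : HeytingField c ℓ₁ ℓ₂)
                  (charZero : FieldOps.CharacteristicZero F)
                  (lam : HeytingField.Carrier F)
                  (lam#0 : HeytingField._#_ F lam (HeytingField.0# F)) where
  open FieldOps F
  open PowerSeries F charZero public

  1/lam : Carrier
  1/lam = lam#0 ⁻¹

  -- (x)_{n,μ} = x (x - μ) ⋯ (x - (n-1)μ)
  falling : Carrier → Carrier → ℕ → Carrier
  falling x μ zero    = 1#
  falling x μ (suc n) = falling x μ n * (x - n × μ)

  binomial : Carrier → ℕ → Carrier
  binomial y n = falling y 1# n * 1/ n !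

  -- e_λ^x(t) = (1 + λt)^{x/λ}
  degExp : Carrier → PS
  degExp x n = binomial (x * 1/lam) n * lam ^ n

  intPower : ∀ n → .{{_ : NonZero n}} → ℤ → Carrier
  intPower n (+ m)    = (n × 1#) ^ m
  intPower n -[1+ m ] = 1/ℕ n ^ suc m

  -- l_{k,λ}(x) = Σ_{n≥1} (-λ)ⁿ⁻¹ (1)_{n,1/λ} / ((n-1)! nᵏ) xⁿ, with n = m + 1.
  polylog : ℤ → PS
  polylog k zero    = 0#
  polylog k (suc m) =
    (- lam) ^ m * falling 1# 1/lam (suc m) * (1/ m ! * intPower (suc m) (ℤ.- k))

  -- 1 - e_λ(-t)
  u : PS
  u = 1ₚ ⊖ reflect (degExp 1#)

  open RingProperties ring using (-‿involutive)
  open ≈-Reasoning setoid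

  1/ℕ1≈1 : 1/ℕ 1 ≈ 1#
  1/ℕ1≈1 = begin
    1/ℕ 1               ≈⟨ *-identityʳ _ ⟨
    1/ℕ 1 * 1#          ≈⟨ *-congˡ (+-identityʳ 1#) ⟨
    1/ℕ 1 * (1# + 0#)   ≈⟨ ⁻¹-inverseˡ (charZero 1) ⟩
    1#                  ∎

  degExp₀ : degExp 1# 0 ≈ 1#
  degExp₀ = begin
    1# * 1/ℕ 1 * 1#   ≈⟨ *-identityʳ _ ⟩
    1# * 1/ℕ 1        ≈⟨ *-identityˡ _ ⟩
    1/ℕ 1             ≈⟨ 1/ℕ1≈1 ⟩
    1#                ∎

  degExp₁ : degExp 1# 1 ≈ 1#
  degExp₁ = begin
    1# * (1# * 1/lam - 0#) * 1/ℕ 1 * (lam * 1#)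
      ≈⟨ *-cong (*-cong (*-identityˡ _) 1/ℕ1≈1) (*-identityʳ lam) ⟩
    (1# * 1/lam - 0#) * 1# * lam
      ≈⟨ *-congʳ (*-identityʳ _) ⟩
    (1# * 1/lam - 0#) * lam
      ≈⟨ *-congʳ (trans (x-0≈x _) (*-identityˡ _)) ⟩
    1/lam * lam
      ≈⟨ ⁻¹-inverseˡ lam#0 ⟩
    1# ∎

  u₁≈1 : u 1 ≈ 1#
  u₁≈1 = begin
    0# - (- 1# * 1#) * degExp 1# 1   ≈⟨ +-identityˡ _ ⟩
    - ((- 1# * 1#) * degExp 1# 1)    ≈⟨ -‿cong (*-cong (*-identityʳ _) degExp₁) ⟩
    - (- 1# * 1#)                    ≈⟨ -‿cong (*-identityʳ _) ⟩
    - (- 1#)                         ≈⟨ -‿involutive 1# ⟩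
    1#                               ∎

  u₀≈0 : u 0 ≈ 0#
  u₀≈0 = begin
    1# - 1# * degExp 1# 0   ≈⟨ +-congˡ (-‿cong (trans (*-identityˡ _) degExp₀)) ⟩
    1# - 1#                 ≈⟨ -‿inverseʳ 1# ⟩
    0#                      ∎

  u₁#0 : u 1 # 0#
  u₁#0 = #-congʳ (sym u₁≈1) 1#0

  -- β_{n,λ}^{(k)} = n! [tⁿ] (l_{k,λ}(x)/x at x = 1 - e_λ(-t))
  polyBernoulli : ℤ → ℕ → Carrier
  polyBernoulli k n =
    ((n !) × 1#) * substitute (divideByVar (polylog k) refl) u u₀≈0 n

  -- f/(1 - e_λ(-t))
  divideByU : (f : PS) → f 0 ≈ 0# → PS
  divideByU f f₀≈0 = quotient f u f₀≈0 u₀≈0 u₁#0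

  order≥1-⊛ : ∀ f g → g 0 ≈ 0# → (f ⊛ g) 0 ≈ 0#
  order≥1-⊛ f g g₀≈0 =
    trans (+-identityʳ _) (trans (*-congˡ g₀≈0) (zeroʳ (f 0)))

  -- The argument counts the integral signs, so J_k is iteratedIntegral (k - 1).
  -- Its vanishing at 0 is what permits dividing by 1 - e_λ(-t) at the next stage.
  mutual
    iteratedIntegral : ℕ → PS
    iteratedIntegral zero    = var
    iteratedIntegral (suc m) =
      ∫₀ (divideByU (e ⊛ iteratedIntegral m)
                    (order≥1-⊛ e (iteratedIntegral m) (iteratedIntegral₀≈0 m)))
      where
      e : PS
      e = reflect (degExp (1# - lam))

    iteratedIntegral₀≈0 : ∀ m → iteratedIntegral m 0 ≈ 0#
    iteratedIntegral₀≈0 zero    = refl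
    iteratedIntegral₀≈0 (suc m) = refl

{-# OPTIONS --safe #-}
-- With u = 1 - e_λ(-t) and l_k the degenerate polylogarithm, J_k = l_k(u) for all
-- k ≥ 1; dividing by u then gives the theorem.  For k > 1 this is the chain rule
-- together with x l_k'(x) = l_{k-1}(x) and u' = e_λ^{1-λ}(-t).  The base case
-- l_1(u) = t amounts to u' G(u) = 1 for G = l_1' = (1-x)^{λ-1}.  Writing E = u', this
-- follows from (1-λt) E' = -(1-λ) E, 1 - u = (1-λt) E and (1-x) G' = (1-λ) G, which
-- give (1-λt) (E G(u))' = 0.
module Submission where

open import Defs
open import Algebra.Apartness.Bundles using (HeytingField)
open import Algebra.Bundles using (CommutativeRing)
import Algebra.Properties.CommutativeMonoid.Sum as Sum
import Algebra.Properties.Ring as RingProperties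
import Algebra.Properties.Semiring.Mult as SemiringMult
import Algebra.Properties.Semiring.Sum as SemiringSum
import Algebra.Solver.Ring.NaturalCoefficients.Default as SemiringSolver
open import Data.Fin.Base using (toℕ)
open import Data.Integer.Base as ℤ using (+_)
open import Data.Nat.Base
  using (ℕ; zero; suc; _≤_; _<_; z≤n; s≤s; s≤s⁻¹; _∸_; _!; NonZero)
open import Data.Nat.Properties using (≤-refl; m≤n⇒m≤1+n; <-≤-trans; _!≢0)
open import Data.Product.Base using (_,_)
open import Data.Unit.Base using (tt)
import Relation.Binary.Reasoning.Setoid as ≈-Reasoning

-- The commutative ring of formal power series.

module SeriesRing {c ℓ₁ ℓ₂} (F : HeytingField c ℓ₁ ℓ₂)
                  (charZero : FieldOps.CharacteristicZero F) where
  open FieldOps F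
  open PowerSeries F charZero
  open CommutativeRing commutativeRing using (commutativeSemiring)
  open ≈-Reasoning setoid
  open SemiringSolver commutativeSemiring
    using (solve; _:+_; _:*_; _:=_)

  infixl 6 _⊕_

  _⊕_ : PS → PS → PS
  (f ⊕ g) n = f n + g n

  ⊝_ : PS → PS
  (⊝ f) n = - f n

  0ₚ : PS
  0ₚ _ = 0#

  shift : PS → PS
  shift f n = f (suc n)

  ⊛-zero : ∀ f g → (f ⊛ g) 0 ≈ f 0 * g 0
  ⊛-zero f g = +-identityʳ _

  -- The product at `suc n` unfolds definitionally to `f 0 * g (suc n) + (shift f ⊛ g) n`. Hence
  -- this and the ring laws below go by induction on the index, with the left factor replaced by its
  -- `shift`.
  ⊛-cong : ∀ {f f′ g g′} → f ≋ f′ → g ≋ g′ → f ⊛ g ≋ f′ ⊛ g′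
  ⊛-cong f≋f′ g≋g′ zero    = +-congʳ (*-cong (f≋f′ 0) (g≋g′ 0))
  ⊛-cong f≋f′ g≋g′ (suc n) =
    +-cong (*-cong (f≋f′ 0) (g≋g′ (suc n))) (⊛-cong (λ i → f≋f′ (suc i)) g≋g′ n)

  ⊛-cong-upto : ∀ f {g g′} n → (∀ j → j ≤ n → g j ≈ g′ j) → (f ⊛ g) n ≈ (f ⊛ g′) n
  ⊛-cong-upto f zero    g≈g′ = +-congʳ (*-congˡ (g≈g′ 0 z≤n))
  ⊛-cong-upto f (suc n) g≈g′ =
    +-cong (*-congˡ (g≈g′ (suc n) ≤-refl))
           (⊛-cong-upto (shift f) n λ j j≤n → g≈g′ j (m≤n⇒m≤1+n j≤n))

  ⊛-zeroˡ : ∀ f → 0ₚ ⊛ f ≋ 0ₚ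
  ⊛-zeroˡ f zero    = trans (⊛-zero 0ₚ f) (zeroˡ _)
  ⊛-zeroˡ f (suc n) = trans (+-cong (zeroˡ _) (⊛-zeroˡ f n)) (+-identityˡ 0#)

  ⊛-identityˡ : ∀ f → 1ₚ ⊛ f ≋ f
  ⊛-identityˡ f zero    = trans (⊛-zero 1ₚ f) (*-identityˡ _)
  ⊛-identityˡ f (suc n) = trans (+-cong (*-identityˡ _) (⊛-zeroˡ f n)) (+-identityʳ _)

  ⊛-distribʳ : ∀ f g h → (g ⊕ h) ⊛ f ≋ g ⊛ f ⊕ h ⊛ f
  ⊛-distribʳ f g h zero    = begin
    ((g ⊕ h) ⊛ f) 0              ≈⟨ ⊛-zero (g ⊕ h) f ⟩
    (g 0 + h 0) * f 0            ≈⟨ distribʳ _ _ _ ⟩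
    g 0 * f 0 + h 0 * f 0        ≈⟨ +-cong (⊛-zero g f) (⊛-zero h f) ⟨
    (g ⊛ f) 0 + (h ⊛ f) 0        ∎
  ⊛-distribʳ f g h (suc n) = begin
    (g 0 + h 0) * f (suc n) + (shift (g ⊕ h) ⊛ f) n
      ≈⟨ +-congˡ (⊛-distribʳ f (shift g) (shift h) n) ⟩
    (g 0 + h 0) * f (suc n) + ((shift g ⊛ f) n + (shift h ⊛ f) n)
      ≈⟨ solve 5 (λ a b c d e → (a :+ b) :* c :+ (d :+ e) := (a :* c :+ d) :+ (b :* c :+ e))
           refl _ _ _ _ _ ⟩
    (g ⊛ f) (suc n) + (h ⊛ f) (suc n) ∎

  ∙-⊛ : ∀ a f g → (a ∙ f) ⊛ g ≋ a ∙ (f ⊛ g)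
  ∙-⊛ a f g zero    = begin
    ((a ∙ f) ⊛ g) 0       ≈⟨ ⊛-zero (a ∙ f) g ⟩
    a * f 0 * g 0         ≈⟨ *-assoc _ _ _ ⟩
    a * (f 0 * g 0)       ≈⟨ *-congˡ (⊛-zero f g) ⟨
    a * (f ⊛ g) 0         ∎
  ∙-⊛ a f g (suc n) = begin
    a * f 0 * g (suc n) + (shift (a ∙ f) ⊛ g) n
      ≈⟨ +-cong (*-assoc _ _ _) (∙-⊛ a (shift f) g n) ⟩
    a * (f 0 * g (suc n)) + a * (shift f ⊛ g) n
      ≈⟨ distribˡ _ _ _ ⟨
    a * (f ⊛ g) (suc n) ∎

  -- Splits off the last summand where the definition splits off the first; comparing the two
  -- splittings gives commutativity.
  ⊛-sucʳ : ∀ f g n → (f ⊛ g) (suc n) ≈ (f ⊛ shift g) n + f (suc n) * g 0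
  ⊛-sucʳ f g zero    = +-cong (sym (⊛-zero f (shift g))) (⊛-zero (shift f) g)
  ⊛-sucʳ f g (suc n) = trans (+-congˡ (⊛-sucʳ (shift f) g n)) (sym (+-assoc _ _ _))

  ⊛-comm : ∀ f g → f ⊛ g ≋ g ⊛ f
  ⊛-comm f g zero    = +-congʳ (*-comm _ _)
  ⊛-comm f g (suc n) = begin
    f 0 * g (suc n) + (shift f ⊛ g) n    ≈⟨ +-cong (*-comm _ _) (⊛-comm (shift f) g n) ⟩
    g (suc n) * f 0 + (g ⊛ shift f) n    ≈⟨ +-comm _ _ ⟩
    (g ⊛ shift f) n + g (suc n) * f 0    ≈⟨ ⊛-sucʳ g f n ⟨
    (g ⊛ f) (suc n)                      ∎

  ⊛-assoc : ∀ f g h → (f ⊛ g) ⊛ h ≋ f ⊛ (g ⊛ h)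
  ⊛-assoc f g h zero    = begin
    ((f ⊛ g) ⊛ h) 0       ≈⟨ trans (⊛-zero (f ⊛ g) h) (*-congʳ (⊛-zero f g)) ⟩
    f 0 * g 0 * h 0       ≈⟨ *-assoc _ _ _ ⟩
    f 0 * (g 0 * h 0)     ≈⟨ trans (⊛-zero f (g ⊛ h)) (*-congˡ (⊛-zero g h)) ⟨
    (f ⊛ (g ⊛ h)) 0       ∎
  ⊛-assoc f g h (suc n) = begin
    -- By definition `shift (f ⊛ g)` is `f 0 ∙ shift g ⊕ shift f ⊛ g`.
    (f ⊛ g) 0 * h (suc n) + ((f 0 ∙ shift g ⊕ shift f ⊛ g) ⊛ h) n
      ≈⟨ +-cong (*-congʳ (⊛-zero f g)) (⊛-distribʳ h (f 0 ∙ shift g) (shift f ⊛ g) n) ⟩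
    f 0 * g 0 * h (suc n) + (((f 0 ∙ shift g) ⊛ h) n + ((shift f ⊛ g) ⊛ h) n)
      ≈⟨ +-congˡ (+-cong (∙-⊛ (f 0) (shift g) h n) (⊛-assoc (shift f) g h n)) ⟩
    f 0 * g 0 * h (suc n) + (f 0 * (shift g ⊛ h) n + (shift f ⊛ (g ⊛ h)) n)
      ≈⟨ solve 5 (λ a b c d e → a :* b :* c :+ (a :* d :+ e) := a :* (b :* c :+ d) :+ e)
           refl _ _ _ _ _ ⟩
    f 0 * (g ⊛ h) (suc n) + (shift f ⊛ (g ⊛ h)) n ∎

  seriesRing : CommutativeRing c ℓ₁
  seriesRing = record
    { Carrier = PS
    ; _≈_ = _≋_
    ; _+_ = _⊕_
    ; _*_ = _⊛_
    ; -_  = ⊝_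
    ; 0#  = 0ₚ
    ; 1#  = 1ₚ
    ; isCommutativeRing = record
      { isRing = record
        { +-isAbelianGroup = record
          { isGroup = record
            { isMonoid = record
              { isSemigroup = record
                { isMagma = record
                  { isEquivalence = record
                    { refl  = λ _ → refl
                    ; sym   = λ p n → sym (p n)
                    ; trans = λ p q n → trans (p n) (q n)
                    }
                  ; ∙-cong = λ p q n → +-cong (p n) (q n)
                  }
                ; assoc = λ f g h n → +-assoc (f n) (g n) (h n)
                }
              ; identity = (λ f n → +-identityˡ (f n)) , (λ f n → +-identityʳ (f n))
              }
            ; inverse = (λ f n → -‿inverseˡ (f n)) , (λ f n → -‿inverseʳ (f n))
            ; ⁻¹-cong = λ p n → -‿cong (p n)
            }
          ; comm = λ f g n → +-comm (f n) (g n)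
          }
        ; *-cong = ⊛-cong
        ; *-assoc = ⊛-assoc
        ; *-identity = ⊛-identityˡ , λ f n → trans (⊛-comm f 1ₚ n) (⊛-identityˡ f n)
        ; distrib =
            (λ f g h n → trans (⊛-comm f (g ⊕ h) n)
                          (trans (⊛-distribʳ f g h n) (+-cong (⊛-comm g f n) (⊛-comm h f n))))
          , ⊛-distribʳ
        }
      ; *-comm = ⊛-comm
      }
    }

-- Formal differentiation and uniqueness principles.

module Calculus {c ℓ₁ ℓ₂} (F : HeytingField c ℓ₁ ℓ₂)
                (charZero : FieldOps.CharacteristicZero F) where
  open FieldOps F
  open PowerSeries F charZero
  open SeriesRing F charZero
  open CommutativeRing commutativeRing using (commutativeSemiring; +-commutativeMonoid)
  open RingProperties ring
  module S = CommutativeRing seriesRing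
  module SP = RingProperties S.ring
  open Sum +-commutativeMonoid using (∑-distrib-+; sum-cong-≋)
  open SemiringSum semiring using (*-distribˡ-sum)
  open SemiringSolver commutativeSemiring
    using (solve; _:+_; _:*_; _:=_)
  open SemiringSolver S.commutativeSemiring
    using () renaming (solve to solveₛ; _:+_ to _:⊕_; _:*_ to _:⊛_; _:=_ to _:≋_)

  module ≈-R = ≈-Reasoning setoid
  module ≋-R = ≈-Reasoning S.setoid

  ι : ℕ → Carrier
  ι n = n × 1#

  1/ℕ-inverseʳ : ∀ n .{{_ : NonZero n}} → ι n * 1/ℕ n ≈ 1#
  1/ℕ-inverseʳ n = trans (*-comm _ _) (⁻¹-inverseˡ (charZero n))

  ι-cancelˡ : ∀ n .{{_ : NonZero n}} {x y} → ι n * x ≈ ι n * y → x ≈ y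
  ι-cancelˡ n {x} {y} eq = begin
    x                      ≈⟨ *-identityˡ x ⟨
    1# * x                 ≈⟨ *-congʳ (⁻¹-inverseˡ (charZero n)) ⟨
    1/ℕ n * ι n * x        ≈⟨ *-assoc _ _ _ ⟩
    1/ℕ n * (ι n * x)      ≈⟨ *-congˡ eq ⟩
    1/ℕ n * (ι n * y)      ≈⟨ *-assoc _ _ _ ⟨
    1/ℕ n * ι n * y        ≈⟨ *-congʳ (⁻¹-inverseˡ (charZero n)) ⟩
    1# * y                 ≈⟨ *-identityˡ y ⟩
    y                      ∎
    where open ≈-R

  -- Solves an equation `S = c + (1 - g) S`, expanded to `c + (S - g S)`, for `g S`.
  x≈z+[x-y]⇒y≈z : ∀ {x y z} → x ≈ z + (x - y) → y ≈ z
  x≈z+[x-y]⇒y≈z {x} {y} {z} eq = +-cancelˡ x y z (begin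
    x + y              ≈⟨ +-congʳ eq ⟩
    z + (x - y) + y    ≈⟨ +-assoc _ _ _ ⟩
    z + (x - y + y)    ≈⟨ +-congˡ (//-rightDividesˡ y x) ⟩
    z + x              ≈⟨ +-comm _ _ ⟩
    x + z              ∎)
    where open ≈-R

  ∙-cong : ∀ {a b f g} → a ≈ b → f ≋ g → a ∙ f ≋ b ∙ g
  ∙-cong a≈b f≋g n = *-cong a≈b (f≋g n)

  -- θ = t d/dt, so that D = θ/t.
  θ D : PS → PS
  θ f n = ι n * f n
  D f = shift (θ f)

  θ-suc : ∀ f → D f ≋ shift f ⊕ θ (shift f)
  θ-suc f n = trans (distribʳ _ _ _) (+-congʳ (*-identityˡ _))

  -- The Leibniz rule is proved for `θ` first: `θ` does not move the index, so the induction
  -- hypothesis applies to `shift f` directly, and the weight `1# + ι n` can be distributed over the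
  -- summands.
  θ-⊛ : ∀ f g → θ (f ⊛ g) ≋ θ f ⊛ g ⊕ f ⊛ θ g
  θ-⊛ f g zero = begin
    0# * (f ⊛ g) 0                       ≈⟨ zeroˡ _ ⟩
    0#                                   ≈⟨ +-identityˡ 0# ⟨
    0# + 0#                              ≈⟨ +-cong
      (trans (⊛-zero (θ f) g) (trans (*-congʳ (zeroˡ _)) (zeroˡ _)))
      (trans (⊛-zero f (θ g)) (trans (*-congˡ (zeroˡ _)) (zeroʳ _))) ⟨
    (θ f ⊛ g) 0 + (f ⊛ θ g) 0            ∎
    where open ≈-R
  θ-⊛ f g (suc n) = begin
    (1# + ι n) * (f 0 * g (suc n) + (shift f ⊛ g) n)
      ≈⟨ trans (distribʳ _ _ _) (+-cong (*-identityˡ _) (distribˡ _ _ _)) ⟩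
    f 0 * g (suc n) + (shift f ⊛ g) n + (ι n * (f 0 * g (suc n)) + θ (shift f ⊛ g) n)
      ≈⟨ +-congˡ (+-congˡ (θ-⊛ (shift f) g n)) ⟩
    f 0 * g (suc n) + (shift f ⊛ g) n +
      (ι n * (f 0 * g (suc n)) + ((θ (shift f) ⊛ g) n + (shift f ⊛ θ g) n))
      ≈⟨ solve 6 (λ a b c d e i →
           a :* b :+ c :+ (i :* (a :* b) :+ (d :+ e)) :=
           (c :+ d) :+ ((a :* b :+ a :* (i :* b)) :+ e)) refl _ _ _ _ _ _ ⟩
    (shift f ⊛ g) n + (θ (shift f) ⊛ g) n +
      (f 0 * g (suc n) + f 0 * (ι n * g (suc n)) + (shift f ⊛ θ g) n)
      ≈⟨ +-cong (⊛-distribʳ g (shift f) (θ (shift f)) n)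
                (+-congʳ (trans (*-congˡ (θ-suc g n)) (distribˡ _ _ _))) ⟨
    ((shift f ⊕ θ (shift f)) ⊛ g) n + (f ⊛ θ g) (suc n)
      ≈⟨ +-congʳ (⊛-cong {g = g} (θ-suc f) S.refl n) ⟨
    (D f ⊛ g) n + (f ⊛ θ g) (suc n)
      ≈⟨ +-congʳ (trans (+-congʳ (trans (*-congʳ (zeroˡ _)) (zeroˡ _))) (+-identityˡ _)) ⟨
    (θ f ⊛ g) (suc n) + (f ⊛ θ g) (suc n) ∎
    where open ≈-R

  -- `θ f` and `θ g` have zero constant term, so at index `suc n` the first summand of `θ f ⊛ g` and
  -- the last one of `f ⊛ θ g` vanish.
  D-⊛ : ∀ f g → D (f ⊛ g) ≋ D f ⊛ g ⊕ f ⊛ D g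
  D-⊛ f g n = trans (θ-⊛ f g (suc n)) (+-cong
    (trans (+-congʳ (trans (*-congʳ (zeroˡ _)) (zeroˡ _))) (+-identityˡ _))
    (trans (⊛-sucʳ f (θ g) n)
           (trans (+-congˡ (trans (*-congˡ (zeroˡ _)) (zeroʳ _))) (+-identityʳ _))))

  D-cong : ∀ {f g} → f ≋ g → D f ≋ D g
  D-cong f≋g n = *-congˡ (f≋g (suc n))

  D-⊕ : ∀ f g → D (f ⊕ g) ≋ D f ⊕ D g
  D-⊕ f g n = distribˡ _ _ _

  D-constant : ∀ a → D (a ∙ 1ₚ) ≋ 0ₚ
  D-constant a n = trans (*-congˡ (zeroʳ a)) (zeroʳ _)

  D-injective : ∀ {f g} → f 0 ≈ g 0 → D f ≋ D g → f ≋ g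
  D-injective f₀≈g₀ Df≋Dg zero    = f₀≈g₀
  D-injective f₀≈g₀ Df≋Dg (suc n) = ι-cancelˡ (suc n) (Df≋Dg n)

  D-∫₀ : ∀ f → D (∫₀ f) ≋ f
  D-∫₀ f n = begin
    ι (suc n) * (f n * 1/ℕ (suc n))
      ≈⟨ solve 3 (λ a b c → a :* (b :* c) := (a :* c) :* b) refl _ _ _ ⟩
    ι (suc n) * 1/ℕ (suc n) * f n
      ≈⟨ trans (*-congʳ (1/ℕ-inverseʳ (suc n))) (*-identityˡ _) ⟩
    f n ∎
    where open ≈-R

  -- The recurrence determines coefficient `suc n` from coefficient `n`, as `ι (suc n)` is
  -- cancellable in characteristic zero.
  recurrence-unique : ∀ (r : ℕ → Carrier) {f g} → f 0 ≈ g 0 →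
    (∀ n → D f n ≈ r n * f n) → (∀ n → D g n ≈ r n * g n) → f ≋ g
  recurrence-unique r f₀≈g₀ Df Dg zero    = f₀≈g₀
  recurrence-unique r f₀≈g₀ Df Dg (suc n) = ι-cancelˡ (suc n)
    (trans (Df n) (trans (*-congˡ (recurrence-unique r f₀≈g₀ Df Dg n)) (sym (Dg n))))

  ⊛-suc-order≥1 : ∀ {h} → h 0 ≈ 0# → ∀ f n → (h ⊛ f) (suc n) ≈ (shift h ⊛ f) n
  ⊛-suc-order≥1 h₀≈0 f n =
    trans (+-congʳ (trans (*-congʳ h₀≈0) (zeroˡ _))) (+-identityˡ _)

  -- Since `h` has order at least 1, coefficient `n` of the product involves the other factor only
  -- strictly below `n`.
  ⊛-contraction : ∀ {h} → h 0 ≈ 0# → ∀ {f g} n →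
    (∀ j → j < n → f j ≈ g j) → (h ⊛ f) n ≈ (h ⊛ g) n
  ⊛-contraction {h} h₀≈0 {f} {g} zero f≈g =
    trans (⊛-zero h f) (trans (*-congʳ h₀≈0) (trans (zeroˡ _)
      (sym (trans (⊛-zero h g) (trans (*-congʳ h₀≈0) (zeroˡ _))))))
  ⊛-contraction {h} h₀≈0 {f} {g} (suc n) f≈g =
    trans (⊛-suc-order≥1 {h} h₀≈0 f n)
      (trans (⊛-cong-upto (shift h) n λ j j≤n → f≈g j (s≤s j≤n))
        (sym (⊛-suc-order≥1 {h} h₀≈0 g n)))

  -- Two series-valued families obeying the same equation X i = c i + h X (σ i)
  -- agree to ever higher order, because multiplying by h raises the order.
  fixpoint-unique : ∀ {i} {I : Set i} (σ : I → I) (c : I → PS) {h} → h 0 ≈ 0# →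
    ∀ {X Y : I → PS} → (∀ i → X i ≋ c i ⊕ h ⊛ X (σ i)) → (∀ i → Y i ≋ c i ⊕ h ⊛ Y (σ i)) →
    ∀ i → X i ≋ Y i
  fixpoint-unique {I = I} σ c {h} h₀≈0 {X} {Y} X-eq Y-eq i n = go (suc n) n ≤-refl i
    where
    -- Strong induction through the strict bound `N` on `n`; `i` stays general because the recursive
    -- call is made at `σ i`.
    go : ∀ N n → n < N → ∀ i → X i n ≈ Y i n
    go (suc N) n n<sN i = trans (X-eq i n) (trans
      (+-congˡ (⊛-contraction {h} h₀≈0 n
        λ j j<n → go N j (<-≤-trans j<n (s≤s⁻¹ n<sN)) (σ i)))
      (sym (Y-eq i n)))

  -- Substitution of a series with zero constant term.

  module Substitution (h : PS) (h₀≈0 : h 0 ≈ 0#) where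

    sub : PS → PS
    sub f = substitute f h h₀≈0

    -- Here the truncation `N` is independent of the coefficient index. `sub f n` is
    -- `partial f (suc n) n`, whose truncation moves with `n`, so a factor `h` cannot be extracted
    -- from it as a series.
    partial : PS → ℕ → PS
    partial f N n = sum {N} λ i → f (toℕ i) * (h ^ₚ toℕ i) n

    ⊛-sum : ∀ N (a : ℕ → Carrier) (g : ℕ → PS) n →
      sum {N} (λ i → a (toℕ i) * (h ⊛ g (toℕ i)) n)
        ≈ (h ⊛ λ m → sum {N} λ i → a (toℕ i) * g (toℕ i) m) n
    ⊛-sum zero    a g n = sym (S.zeroʳ h n)
    ⊛-sum (suc N) a g n = begin
      a 0 * (h ⊛ g 0) n + sum {N} (λ i → a (suc (toℕ i)) * (h ⊛ g (suc (toℕ i))) n)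
        ≈⟨ +-cong
             (trans (⊛-comm h (a 0 ∙ g 0) n)
               (trans (∙-⊛ (a 0) (g 0) h n) (*-congˡ (⊛-comm (g 0) h n))))
             (sym (⊛-sum N (shift a) (λ i → g (suc i)) n)) ⟨
      (h ⊛ (a 0 ∙ g 0)) n + (h ⊛ λ m → sum {N} λ i → a (suc (toℕ i)) * g (suc (toℕ i)) m) n
        ≈⟨ S.distribˡ h (a 0 ∙ g 0) (λ m → sum {N} λ i → a (suc (toℕ i)) * g (suc (toℕ i)) m) n ⟨
      (h ⊛ λ m → sum {suc N} λ i → a (toℕ i) * g (toℕ i) m) n ∎
      where open ≈-R

    -- One step of Horner's scheme: `h ^ₚ suc i` is `h ⊛ h ^ₚ i`, so all summands but the first
    -- share a factor `h`.
    partial-suc : ∀ f N → partial f (suc N) ≋ f 0 ∙ 1ₚ ⊕ h ⊛ partial (shift f) N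
    partial-suc f N n = +-congˡ (⊛-sum N (shift f) (h ^ₚ_) n)

    partial-stable : ∀ f N n → n < N → partial f N n ≈ sub f n
    partial-stable f N n n<N = go (suc n) n ≤-refl f N n<N
      where
      go : ∀ K n → n < K → ∀ f N → n < N → partial f N n ≈ sub f n
      go (suc K) n n<sK f (suc N) n<sN = trans (partial-suc f N n) (trans
        (+-congˡ (⊛-contraction {h} h₀≈0 n λ j j<n →
          let j<K = <-≤-trans j<n (s≤s⁻¹ n<sK) in
          -- The two tails are truncated at `N` and at `n`; both exceed `j`, so each agrees with
          -- `sub (shift f)` at `j`.
          trans (go K j j<K (shift f) N (<-≤-trans j<n (s≤s⁻¹ n<sN)))
                (sym (go K j j<K (shift f) n j<n))))
        (sym (partial-suc f n n)))

    -- The functional equation on which the chain rule, the extraction of a factor `h` and the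
    -- geometric series below all rest.
    sub-unfold : ∀ f → sub f ≋ f 0 ∙ 1ₚ ⊕ h ⊛ sub (shift f)
    sub-unfold f n = trans (partial-suc f n n)
      (+-congˡ (⊛-contraction {h} h₀≈0 n (partial-stable (shift f) n)))

    sub-cong : ∀ {f g} → f ≋ g → sub f ≋ sub g
    sub-cong f≋g n = sum-cong-≋ {suc n} λ i → *-congʳ {(h ^ₚ toℕ i) n} (f≋g (toℕ i))

    sub-⊕ : ∀ f g → sub (f ⊕ g) ≋ sub f ⊕ sub g
    sub-⊕ f g n = trans (sum-cong-≋ {suc n} λ i → distribʳ ((h ^ₚ toℕ i) n) (f (toℕ i)) (g (toℕ i)))
      (∑-distrib-+ {suc n} (λ i → f (toℕ i) * (h ^ₚ toℕ i) n) λ i → g (toℕ i) * (h ^ₚ toℕ i) n)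

    sub-∙ : ∀ a f → sub (a ∙ f) ≋ a ∙ sub f
    sub-∙ a f n = trans (sum-cong-≋ {suc n} λ i → *-assoc a (f (toℕ i)) ((h ^ₚ toℕ i) n))
      (sym (*-distribˡ-sum {suc n} a λ i → f (toℕ i) * (h ^ₚ toℕ i) n))

    sub-order≥1 : ∀ f → f 0 ≈ 0# → sub f ≋ h ⊛ sub (shift f)
    sub-order≥1 f f₀≈0 n = trans (sub-unfold f n)
      (trans (+-congʳ (trans (*-congʳ f₀≈0) (zeroˡ _))) (+-identityˡ _))

    -- Both sides, as families indexed by `f`, solve `X f = D h ⊛ sub (shift f) ⊕ h ⊛ X (shift f)`:
    -- the left by the product rule, the right because `D f` is `shift f ⊕ θ (shift f)` and the
    -- second term yields a factor `h`.
    chain-rule : ∀ f → D (sub f) ≋ D h ⊛ sub (D f)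
    chain-rule = fixpoint-unique shift (λ f → D h ⊛ sub (shift f)) {h} h₀≈0 lhs rhs
      where
      open ≋-R
      lhs : ∀ f → D (sub f) ≋ D h ⊛ sub (shift f) ⊕ h ⊛ D (sub (shift f))
      lhs f = begin
        D (sub f)
          ≈⟨ D-cong (sub-unfold f) ⟩
        D (f 0 ∙ 1ₚ ⊕ h ⊛ sub (shift f))
          ≈⟨ D-⊕ (f 0 ∙ 1ₚ) (h ⊛ sub (shift f)) ⟩
        D (f 0 ∙ 1ₚ) ⊕ D (h ⊛ sub (shift f))
          ≈⟨ S.+-cong (D-constant (f 0)) (D-⊛ h (sub (shift f))) ⟩
        0ₚ ⊕ (D h ⊛ sub (shift f) ⊕ h ⊛ D (sub (shift f)))
          ≈⟨ S.+-identityˡ _ ⟩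
        D h ⊛ sub (shift f) ⊕ h ⊛ D (sub (shift f)) ∎
      rhs : ∀ f → D h ⊛ sub (D f) ≋ D h ⊛ sub (shift f) ⊕ h ⊛ (D h ⊛ sub (D (shift f)))
      rhs f = begin
        D h ⊛ sub (D f)
          ≈⟨ S.*-congˡ {D h} (S.trans (sub-cong (θ-suc f)) (sub-⊕ (shift f) (θ (shift f)))) ⟩
        D h ⊛ (sub (shift f) ⊕ sub (θ (shift f)))
          ≈⟨ S.*-congˡ {D h} (S.+-congˡ {sub (shift f)} (sub-order≥1 (θ (shift f)) (zeroˡ _))) ⟩
        D h ⊛ (sub (shift f) ⊕ h ⊛ sub (D (shift f)))
          ≈⟨ solveₛ 4 (λ a b c d → a :⊛ (b :⊕ c :⊛ d) :≋ a :⊛ b :⊕ c :⊛ (a :⊛ d)) S.refl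
               (D h) (sub (shift f)) h (sub (D (shift f))) ⟩
        D h ⊛ sub (shift f) ⊕ h ⊛ (D h ⊛ sub (D (shift f))) ∎

  -- Reciprocals and quotients.

  -- The geometric series satisfies `G = 1 + w G`; with `w = 1 - a g` this reads
  -- `G = 1 + (G - a g G)`, hence `a g G = 1`.
  inverse-inverseʳ : ∀ g (g₀#0 : g 0 # 0#) → g ⊛ inverse g g₀#0 ≋ 1ₚ
  inverse-inverseʳ g g₀#0 = begin
    g ⊛ (a ∙ G)           ≈⟨ S.trans (⊛-comm g (a ∙ G)) (S.trans (∙-⊛ a G g)
                               (S.trans (∙-cong refl (⊛-comm G g)) (S.sym (∙-⊛ a g G)))) ⟩
    (a ∙ g) ⊛ G           ≈⟨ (λ n → x≈z+[x-y]⇒y≈z (trans (G-unfold n) (+-congˡ (w⊛G n)))) ⟩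
    1ₚ                    ∎
    where
    open ≋-R
    a : Carrier
    a = g₀#0 ⁻¹
    w : PS
    w = 1ₚ ⊖ a ∙ g
    open Substitution w (1-x⁻¹x≈0 g₀#0)
    G : PS
    G = sub (λ _ → 1#)
    G-unfold : G ≋ 1ₚ ⊕ w ⊛ G
    -- The constant sequence is its own `shift`, so the tail is `G` again.
    G-unfold n = trans (sub-unfold (λ _ → 1#) n) (+-congʳ (*-identityˡ _))
    w⊛G : w ⊛ G ≋ G ⊖ (a ∙ g) ⊛ G
    w⊛G = S.trans (SP.[y-z]x≈yx-zx G 1ₚ (a ∙ g)) (λ n → +-congʳ (⊛-identityˡ G n))

  -- Cancelling one `t` turns `f = g q` into `f/t = (g/t) q`, and `g/t` is invertible. Every later
  -- quotient by `u` is evaluated through this criterion.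
  quotient-unique : ∀ f g q (f₀≈0 : f 0 ≈ 0#) (g₀≈0 : g 0 ≈ 0#) (g₁#0 : g 1 # 0#) →
    f ≋ g ⊛ q → quotient f g f₀≈0 g₀≈0 g₁#0 ≋ q
  quotient-unique f g q f₀≈0 g₀≈0 g₁#0 f≋gq = begin
    shift f ⊛ g/t⁻¹             ≈⟨ S.*-congʳ {g/t⁻¹} (λ n → trans (f≋gq (suc n))
                                     (⊛-suc-order≥1 {g} g₀≈0 q n)) ⟩
    (shift g ⊛ q) ⊛ g/t⁻¹       ≈⟨ solveₛ 3 (λ a b c → (a :⊛ b) :⊛ c :≋ (a :⊛ c) :⊛ b)
                                     S.refl (shift g) q g/t⁻¹ ⟩
    (shift g ⊛ g/t⁻¹) ⊛ q       ≈⟨ S.*-congʳ {q} (inverse-inverseʳ (shift g) g₁#0) ⟩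
    1ₚ ⊛ q                      ≈⟨ ⊛-identityˡ q ⟩
    q                           ∎
    where
    open ≋-R
    g/t⁻¹ : PS
    g/t⁻¹ = inverse (shift g) g₁#0

-- Differential equations of the degenerate exponential.

module PolylogOfU {c ℓ₁ ℓ₂} (F : HeytingField c ℓ₁ ℓ₂)
                  (charZero : FieldOps.CharacteristicZero F)
                  (lam : HeytingField.Carrier F)
                  (lam#0 : HeytingField._#_ F lam (HeytingField.0# F)) where
  open FieldOps F
  open Degenerate F charZero lam lam#0
  open SeriesRing F charZero
  open Calculus F charZero
  open Substitution u u₀≈0
  open CommutativeRing commutativeRing using (commutativeSemiring)
  open RingProperties ring
  open SemiringMult semiring using (×1-homo-*; ×-assoc-*; ×-congʳ)
  open SemiringSolver commutativeSemiring
    using (solve; _:+_; _:*_; _:=_)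
  open SemiringSolver S.commutativeSemiring
    using () renaming (solve to solveₛ; _:+_ to _:⊕_; _:*_ to _:⊛_; _:=_ to _:≋_)

  1/!-suc : ∀ n → ι (suc n) * 1/ suc n ! ≈ 1/ n !
  1/!-suc n = ι-cancelˡ (n !) {{n !≢0}} (begin
    ι (n !) * (ι (suc n) * 1/ suc n !)
      ≈⟨ solve 3 (λ a b c → a :* (b :* c) := (b :* a) :* c) refl _ _ _ ⟩
    ι (suc n) * ι (n !) * 1/ suc n !
      ≈⟨ *-congʳ (×1-homo-* (suc n) (n !)) ⟨
    ι (suc n !) * 1/ suc n !
      ≈⟨ 1/ℕ-inverseʳ (suc n !) {{suc n !≢0}} ⟩
    1#
      ≈⟨ 1/ℕ-inverseʳ (n !) {{n !≢0}} ⟨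
    ι (n !) * 1/ n ! ∎)
    where open ≈-R

  -- Coefficient form of (1 + λt) e' = x e. The ratio comes from the last factor `y - ι n` of the
  -- falling factorial, multiplied by λ.
  D-degExp : ∀ x n → D (degExp x) n ≈ (x - ι n * lam) * degExp x n
  D-degExp x n = begin
    ι (suc n) * (falling y 1# n * (y - ι n) * 1/ suc n ! * (lam * lam ^ n))
      ≈⟨ solve 6 (λ i f d v l p → i :* (f :* d :* v :* (l :* p)) := d :* l :* (f :* (i :* v) :* p))
           refl _ _ _ _ _ _ ⟩
    (y - ι n) * lam * (falling y 1# n * (ι (suc n) * 1/ suc n !) * lam ^ n)
      ≈⟨ *-cong scale (*-congʳ (*-congˡ (1/!-suc n))) ⟩
    (x - ι n * lam) * degExp x n ∎
    where
    open ≈-R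
    y : Carrier
    y = x * 1/lam
    scale : (y - ι n) * lam ≈ x - ι n * lam
    scale = begin
      (y - ι n) * lam            ≈⟨ [y-z]x≈yx-zx lam y (ι n) ⟩
      y * lam - ι n * lam        ≈⟨ +-congʳ (trans (*-assoc _ _ _)
                                      (trans (*-congˡ (⁻¹-inverseˡ lam#0)) (*-identityʳ x))) ⟩
      x - ι n * lam              ∎

  exp⁻ : Carrier → PS   -- e_λ^x(-t)
  exp⁻ x = reflect (degExp x)

  exp⁻₀ : ∀ x → exp⁻ x 0 ≈ 1#
  exp⁻₀ x = trans (*-identityˡ _) degExp₀

  D-exp⁻ : ∀ x n → D (exp⁻ x) n ≈ (ι n * lam - x) * exp⁻ x n
  D-exp⁻ x n = begin
    ι (suc n) * (- 1# * (- 1#) ^ n * degExp x (suc n))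
      ≈⟨ solve 4 (λ i m s e → i :* (m :* s :* e) := m :* (s :* (i :* e))) refl _ _ _ _ ⟩
    - 1# * ((- 1#) ^ n * D (degExp x) n)
      ≈⟨ *-congˡ (*-congˡ (D-degExp x n)) ⟩
    - 1# * ((- 1#) ^ n * ((x - ι n * lam) * degExp x n))
      ≈⟨ solve 4 (λ m s r e → m :* (s :* (r :* e)) := (m :* r) :* (s :* e)) refl _ _ _ _ ⟩
    - 1# * (x - ι n * lam) * exp⁻ x n
      ≈⟨ *-congʳ (trans (-1*x≈-x _) (⁻¹-anti-homo‿- x (ι n * lam))) ⟩
    (ι n * lam - x) * exp⁻ x n ∎
    where open ≈-R

  1-λ : Carrier
  1-λ = 1# - lam

  D-u : D u ≋ ⊝ D (exp⁻ 1#)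
  D-u n = trans (*-congˡ (+-identityˡ _)) (sym (-‿distribʳ-* _ _))

  -- Differentiating moves the recurrence of `exp⁻ 1#` up one index, and the ratio (n+1)λ - 1 is nλ
  -- - (1-λ), the one for `exp⁻ 1-λ`.
  D-u≋exp⁻ : D u ≋ exp⁻ 1-λ
  D-u≋exp⁻ = recurrence-unique (λ n → ι n * lam - 1-λ) initial recurrence (D-exp⁻ 1-λ)
    where
    open ≈-R
    initial : D u 0 ≈ exp⁻ 1-λ 0
    initial = trans (*-cong (+-identityʳ 1#) u₁≈1) (trans (*-identityˡ 1#) (sym (exp⁻₀ 1-λ)))
    coefficient : ∀ n → ι (suc n) * lam - 1# ≈ ι n * lam - 1-λ
    coefficient n = begin
      (1# + ι n) * lam - 1#
        ≈⟨ +-congʳ (trans (distribʳ _ _ _) (+-congʳ (*-identityˡ lam))) ⟩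
      lam + ι n * lam - 1#
        ≈⟨ solve 3 (λ a b c → a :+ b :+ c := b :+ (a :+ c)) refl _ _ _ ⟩
      ι n * lam + (lam - 1#)
        ≈⟨ +-congˡ (⁻¹-anti-homo‿- 1# lam) ⟨
      ι n * lam - 1-λ ∎
    recurrence : ∀ n → D (D u) n ≈ (ι n * lam - 1-λ) * D u n
    recurrence n = begin
      ι (suc n) * D u (suc n)
        ≈⟨ *-congˡ (D-u (suc n)) ⟩
      ι (suc n) * - D (exp⁻ 1#) (suc n)
        ≈⟨ *-congˡ (-‿cong (D-exp⁻ 1# (suc n))) ⟩
      ι (suc n) * - ((ι (suc n) * lam - 1#) * exp⁻ 1# (suc n))
        ≈⟨ *-congˡ (-‿distribʳ-* _ _) ⟩
      ι (suc n) * ((ι (suc n) * lam - 1#) * - exp⁻ 1# (suc n))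
        ≈⟨ solve 3 (λ i r e → i :* (r :* e) := r :* (i :* e)) refl _ _ _ ⟩
      (ι (suc n) * lam - 1#) * (ι (suc n) * - exp⁻ 1# (suc n))
        ≈⟨ *-cong (coefficient n) (*-congˡ (sym (+-identityˡ _))) ⟩
      (ι n * lam - 1-λ) * D u n ∎

  1-λt : PS
  1-λt = 1ₚ ⊖ lam ∙ var

  1-λt-⊛ : ∀ f → 1-λt ⊛ f ≋ f ⊖ (lam ∙ var) ⊛ f
  1-λt-⊛ f = S.trans (SP.[y-z]x≈yx-zx f 1ₚ (lam ∙ var)) (λ n → +-congʳ (⊛-identityˡ f n))

  -- The hypothesis says f = λt f. Zero solves the same equation, and λt has order 1, so uniqueness
  -- of fixpoints applies to a one-element family.
  1-λt-cancel : ∀ {f} → 1-λt ⊛ f ≋ 0ₚ → f ≋ 0ₚ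
  1-λt-cancel {f} eq = fixpoint-unique (λ _ → tt) (λ _ → 0ₚ) {lam ∙ var} (zeroʳ lam)
    {λ _ → f} {λ _ → 0ₚ}
    (λ _ n → trans (x∙y⁻¹≈ε⇒x≈y _ _ (trans (sym (1-λt-⊛ f n)) (eq n))) (sym (+-identityˡ _)))
    (λ _ → S.sym (S.trans (S.+-identityˡ _) (S.zeroʳ (lam ∙ var)))) tt

  shift-var : shift var ≋ 1ₚ
  shift-var zero    = refl
  shift-var (suc n) = refl

  var-⊛-D : ∀ f → var ⊛ D f ≋ θ f
  var-⊛-D f zero    = trans (⊛-zero var (D f)) (trans (zeroˡ _) (sym (zeroˡ _)))
  var-⊛-D f (suc n) = trans (⊛-suc-order≥1 {var} refl (D f) n)
    (trans (⊛-cong {g = D f} shift-var S.refl n) (⊛-identityˡ (D f) n))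

  -- The part `ι n * lam` of the recurrence is the contribution of λt e', which multiplication by 1
  -- - λt removes.
  exp⁻-ode : ∀ x → 1-λt ⊛ D (exp⁻ x) ≋ ⊝ (x ∙ exp⁻ x)
  exp⁻-ode x n = begin
    (1-λt ⊛ D e) n
      ≈⟨ 1-λt-⊛ (D e) n ⟩
    D e n - ((lam ∙ var) ⊛ D e) n
      ≈⟨ +-cong (D-exp⁻ x n) (-‿cong (trans (∙-⊛ lam var (D e) n) (*-congˡ (var-⊛-D e n)))) ⟩
    (ι n * lam - x) * e n - lam * (ι n * e n)
      ≈⟨ +-cong ([y-z]x≈yx-zx _ _ _)
           (-‿cong (solve 3 (λ l i e → l :* (i :* e) := i :* l :* e) refl _ _ _)) ⟩
    ι n * lam * e n - x * e n - ι n * lam * e n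
      ≈⟨ xyx⁻¹≈y _ _ ⟩
    - (x * e n) ∎
    where
    open ≈-R
    e : PS
    e = exp⁻ x

  -- As `exp⁻ 1-λ` is minus the derivative of `exp⁻ 1#`, this is the differential equation at x = 1.
  exp⁻1-factor : 1-λt ⊛ exp⁻ 1-λ ≋ exp⁻ 1#
  exp⁻1-factor = begin
    1-λt ⊛ exp⁻ 1-λ           ≈⟨ S.*-congˡ {1-λt} (S.trans (S.sym D-u≋exp⁻) D-u) ⟩
    1-λt ⊛ (⊝ D (exp⁻ 1#))    ≈⟨ SP.-‿distribʳ-* 1-λt (D (exp⁻ 1#)) ⟨
    ⊝ (1-λt ⊛ D (exp⁻ 1#))    ≈⟨ S.-‿cong (exp⁻-ode 1#) ⟩
    ⊝ (⊝ (1# ∙ exp⁻ 1#))      ≈⟨ SP.-‿involutive (1# ∙ exp⁻ 1#) ⟩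
    1# ∙ exp⁻ 1#              ≈⟨ (λ n → *-identityˡ (exp⁻ 1# n)) ⟩
    exp⁻ 1#                   ∎
    where open ≋-R

  -- The base case: substituting u into the derivative of l_1.

  -- l_1' = (1-x)^{λ-1}, as x l_1' = l_0
  G : PS
  G = shift (polylog (+ 0))

  -- Coefficient form of (1-x) G' = (1-λ) G; the ratio of successive coefficients rests on -λ (1 -
  -- (m+1)/λ) = m + (1-λ).
  D-G : D G ≋ θ G ⊕ 1-λ ∙ G
  D-G m = begin
    ι (suc m) * (- lam * (- lam) ^ m * (f * d) * (1/ suc m ! * 1#))
      ≈⟨ solve 7 (λ i l p f d v o → i :* (l :* p :* (f :* d) :* (v :* o)) :=
           l :* d :* (p :* f :* ((i :* v) :* o))) refl _ _ _ _ _ _ _ ⟩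
    - lam * d * ((- lam) ^ m * f * (ι (suc m) * 1/ suc m ! * 1#))
      ≈⟨ *-cong ratio (*-congˡ (*-congʳ (1/!-suc m))) ⟩
    (ι m + 1-λ) * G m
      ≈⟨ distribʳ _ _ _ ⟩
    ι m * G m + 1-λ * G m ∎
    where
    open ≈-R
    f d : Carrier
    f = falling 1# 1/lam (suc m)
    d = 1# - suc m × 1/lam
    λn/λ : lam * (suc m × 1/lam) ≈ ι (suc m)
    λn/λ = begin
      lam * (suc m × 1/lam)
        ≈⟨ *-comm _ _ ⟩
      (suc m × 1/lam) * lam
        ≈⟨ ×-assoc-* (suc m) 1/lam lam ⟩
      suc m × (1/lam * lam)
        ≈⟨ ×-congʳ (suc m) (⁻¹-inverseˡ lam#0) ⟩
      ι (suc m) ∎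
    ratio : - lam * d ≈ ι m + 1-λ
    ratio = begin
      - lam * d
        ≈⟨ -‿distribˡ-* _ _ ⟨
      - (lam * d)
        ≈⟨ -‿cong (x[y-z]≈xy-xz _ _ _) ⟩
      - (lam * 1# - lam * (suc m × 1/lam))
        ≈⟨ ⁻¹-anti-homo‿- _ _ ⟩
      lam * (suc m × 1/lam) - lam * 1#
        ≈⟨ +-cong λn/λ (-‿cong (*-identityʳ lam)) ⟩
      1# + ι m - lam
        ≈⟨ solve 3 (λ a b c → a :+ b :+ c := b :+ (a :+ c)) refl _ _ _ ⟩
      ι m + 1-λ ∎

  -- This is (1-x) G' = (1-λ) G at x = u: the term `θ G` becomes `u ⊛ sub (D G)`, and `u` is
  -- `1ₚ ⊖ exp⁻ 1#`.
  exp⁻1-⊛-sub-D-G : exp⁻ 1# ⊛ sub (D G) ≋ 1-λ ∙ sub G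
  exp⁻1-⊛-sub-D-G n = x≈z+[x-y]⇒y≈z (begin
    sub (D G) n
      ≈⟨ sub-cong D-G n ⟩
    sub (θ G ⊕ 1-λ ∙ G) n
      ≈⟨ sub-⊕ (θ G) (1-λ ∙ G) n ⟩
    sub (θ G) n + sub (1-λ ∙ G) n
      ≈⟨ +-cong (sub-order≥1 (θ G) (zeroˡ _) n) (sub-∙ 1-λ G n) ⟩
    (u ⊛ sub (D G)) n + 1-λ * sub G n
      ≈⟨ +-comm _ _ ⟩
    1-λ * sub G n + (u ⊛ sub (D G)) n
      ≈⟨ +-congˡ (trans (SP.[y-z]x≈yx-zx (sub (D G)) 1ₚ (exp⁻ 1#) n)
                        (+-congʳ (⊛-identityˡ (sub (D G)) n))) ⟩
    1-λ * sub G n + (sub (D G) n - (exp⁻ 1# ⊛ sub (D G)) n) ∎)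
    where open ≈-R

  D-exp⁻-⊛-sub-G : D (exp⁻ 1-λ ⊛ sub G) ≋ 0ₚ
  D-exp⁻-⊛-sub-G = 1-λt-cancel (begin
    1-λt ⊛ D (E ⊛ P)
      ≈⟨ S.*-congˡ {1-λt} (D-⊛ E P) ⟩
    1-λt ⊛ (D E ⊛ P ⊕ E ⊛ D P)
      ≈⟨ S.*-congˡ {1-λt} (S.+-congˡ {D E ⊛ P} (S.*-congˡ {E}
           (S.trans (chain-rule G) (S.*-congʳ {Q} D-u≋exp⁻)))) ⟩
    1-λt ⊛ (D E ⊛ P ⊕ E ⊛ (E ⊛ Q))
      -- In the second term `1-λt` is paired with one of the two factors `E`, forming `exp⁻ 1#` next
      -- to `Q`.
      ≈⟨ solveₛ 5 (λ l d p e q → l :⊛ (d :⊛ p :⊕ e :⊛ (e :⊛ q)) :≋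
           (l :⊛ d) :⊛ p :⊕ ((l :⊛ e) :⊛ q) :⊛ e) S.refl 1-λt (D E) P E Q ⟩
    (1-λt ⊛ D E) ⊛ P ⊕ ((1-λt ⊛ E) ⊛ Q) ⊛ E
      ≈⟨ S.+-cong (S.*-congʳ {P} (exp⁻-ode 1-λ))
           (S.*-congʳ {E} (S.trans (S.*-congʳ {Q} exp⁻1-factor) exp⁻1-⊛-sub-D-G)) ⟩
    (⊝ (1-λ ∙ E)) ⊛ P ⊕ (1-λ ∙ P) ⊛ E
      ≈⟨ S.+-cong (S.trans (S.sym (SP.-‿distribˡ-* (1-λ ∙ E) P)) (S.-‿cong (∙-⊛ 1-λ E P)))
           (S.trans (∙-⊛ 1-λ P E) (∙-cong refl (⊛-comm P E))) ⟩
    ⊝ (1-λ ∙ (E ⊛ P)) ⊕ 1-λ ∙ (E ⊛ P)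
      ≈⟨ S.-‿inverseˡ _ ⟩
    0ₚ ∎)
    where
    open ≋-R
    E P Q : PS
    E = exp⁻ 1-λ
    P = sub G
    Q = sub (D G)

  -- The derivative of l_1(u) = t. The product is constant by the preceding lemma, and its constant
  -- term is 1.
  exp⁻-⊛-sub-G : exp⁻ 1-λ ⊛ sub G ≋ 1ₚ
  exp⁻-⊛-sub-G = D-injective initial
    (S.trans D-exp⁻-⊛-sub-G (λ n → sym (zeroʳ (ι (suc n)))))
    where
    open ≈-R
    G₀ : G 0 ≈ 1#
    G₀ = begin
      1# * (1# * (1# - 0#)) * (1/ℕ 1 * 1#)
        ≈⟨ *-cong (trans (*-identityˡ _) (trans (*-identityˡ _) (x-0≈x 1#)))
                  (trans (*-identityʳ _) 1/ℕ1≈1) ⟩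
      1# * 1#
        ≈⟨ *-identityˡ 1# ⟩
      1# ∎
    initial : (exp⁻ 1-λ ⊛ sub G) 0 ≈ 1#
    initial = begin
      (exp⁻ 1-λ ⊛ sub G) 0      ≈⟨ ⊛-zero (exp⁻ 1-λ) (sub G) ⟩
      exp⁻ 1-λ 0 * sub G 0      ≈⟨ *-cong (exp⁻₀ 1-λ)
                                     (trans (+-identityʳ _) (trans (*-identityʳ _) G₀)) ⟩
      1# * 1#                   ≈⟨ *-identityˡ 1# ⟩
      1#                        ∎

  -- Polylogarithms of higher order and the iterated integral.

  intPower-suc : ∀ n .{{_ : NonZero n}} k →
    ι n * intPower n (ℤ.- + suc k) ≈ intPower n (ℤ.- + k)
  -- Here the exponent passes from -1 to 0, where `intPower` changes clause.
  intPower-suc n zero    = trans (*-congˡ (*-identityʳ _)) (1/ℕ-inverseʳ n)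
  intPower-suc n (suc k) =
    trans (sym (*-assoc _ _ _)) (trans (*-congʳ (1/ℕ-inverseʳ n)) (*-identityˡ _))

  D-polylog : ∀ k → D (polylog (+ suc k)) ≋ shift (polylog (+ k))
  D-polylog k n = trans
    (solve 4 (λ i a v p → i :* (a :* (v :* p)) := a :* (v :* (i :* p))) refl _ _ _ _)
    (*-congˡ (*-congˡ (intPower-suc (suc n) k)))

  D-sub-polylog : ∀ k →
    D (sub (polylog (+ suc k))) ≋ exp⁻ 1-λ ⊛ sub (shift (polylog (+ k)))
  D-sub-polylog k =
    S.trans (chain-rule (polylog (+ suc k))) (S.*-cong D-u≋exp⁻ (sub-cong (D-polylog k)))

  sub-polylog₀ : ∀ k → sub (polylog k) 0 ≈ 0#
  sub-polylog₀ k = trans (+-identityʳ _) (zeroˡ _)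

  sub-polylog : ∀ k → sub (polylog k) ≋ u ⊛ sub (shift (polylog k))
  sub-polylog k = sub-order≥1 (polylog k) refl

  -- Both sides vanish at 0, so derivatives are compared. The integrand is e J / u; by induction J =
  -- u L, which leaves e L, the derivative of the next polylogarithm at u.
  iteratedIntegral≋polylog : ∀ m → iteratedIntegral m ≋ sub (polylog (+ suc m))
  iteratedIntegral≋polylog zero = D-injective (sym (sub-polylog₀ (+ 1)))
    (S.trans D-var (S.sym (S.trans (D-sub-polylog 0) exp⁻-⊛-sub-G)))
    where
    D-var : D var ≋ 1ₚ
    D-var zero    = trans (*-identityʳ _) (+-identityʳ 1#)
    D-var (suc n) = zeroʳ _
  iteratedIntegral≋polylog (suc m) = D-injective (sym (sub-polylog₀ (+ suc (suc m)))) (begin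
    D (∫₀ (divideByU (e ⊛ J) eJ₀≈0))    ≈⟨ D-∫₀ (divideByU (e ⊛ J) eJ₀≈0) ⟩
    divideByU (e ⊛ J) eJ₀≈0             ≈⟨ quotient-unique (e ⊛ J) u (e ⊛ L) eJ₀≈0 u₀≈0 u₁#0 e⊛J ⟩
    e ⊛ L                               ≈⟨ D-sub-polylog (suc m) ⟨
    D (sub (polylog (+ suc (suc m))))   ∎)
    where
    open ≋-R
    e J L : PS
    e = exp⁻ 1-λ
    J = iteratedIntegral m
    L = sub (shift (polylog (+ suc m)))
    eJ₀≈0 : (e ⊛ J) 0 ≈ 0#
    eJ₀≈0 = order≥1-⊛ e J (iteratedIntegral₀≈0 m)
    e⊛J : e ⊛ J ≋ u ⊛ (e ⊛ L)
    e⊛J = S.trans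
      (S.*-congˡ {e} (S.trans (iteratedIntegral≋polylog m) (sub-polylog (+ suc m))))
      (solveₛ 3 (λ e u l → e :⊛ (u :⊛ l) :≋ u :⊛ (e :⊛ l)) S.refl e u L)

  egf-polyBernoulli : ∀ k → egf (polyBernoulli k) ≋ sub (shift (polylog k))
  egf-polyBernoulli k n = begin
    ι (n !) * sub (shift (polylog k)) n * 1/ n !
      ≈⟨ solve 3 (λ a b c → a :* b :* c := (a :* c) :* b) refl _ _ _ ⟩
    ι (n !) * 1/ n ! * sub (shift (polylog k)) n
      ≈⟨ trans (*-congʳ (1/ℕ-inverseʳ (n !) {{n !≢0}})) (*-identityˡ _) ⟩
    sub (shift (polylog k)) n ∎
    where open ≈-R

theorem3 : ∀ {c ℓ₁ ℓ₂} (F : HeytingField c ℓ₁ ℓ₂) (let open HeytingField F)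
    (charZero : FieldOps.CharacteristicZero F)
    (lam : Carrier) (lam#0 : lam # 0#)
    (k : ℕ) → 2 ≤ k →
    let open Degenerate F charZero lam lam#0 in
    egf (polyBernoulli (+ k))
    ≋ divideByU (iteratedIntegral (k ∸ 1)) (iteratedIntegral₀≈0 (k ∸ 1))
theorem3 F charZero lam lam#0 (suc m) _ =
  S.trans (egf-polyBernoulli (+ suc m))
    -- J_k = l_k(u) is u times the series l_k(x)/x at x = u, so dividing by u gives back the
    -- generating function.
    (S.sym (quotient-unique (iteratedIntegral m) u _ (iteratedIntegral₀≈0 m) u₀≈0 u₁#0
      (S.trans (iteratedIntegral≋polylog m) (sub-polylog (+ suc m)))))
  where
  open Degenerate F charZero lam lam#0
  open Calculus F charZero
  open PolylogOfU F charZero lam lam#0
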